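{- For $r, \sigma, \delta, m\in \mathbb N$ with $r \geq 2$ and $\log^{(2\delta)}m\geq 1$, we have $\chi(W_r(m,\sigma,\delta)) \leq 2^{2^{2+r^{\sigma + \delta - 2}(r+1)}} \cdot \log^{(2\delta)}m$.
   Context: $\log^{(j)}$ denotes the base-2 logarithm iterated $j$ times ($\log^{(0)}m=m$). The graph $W_r(m,\sigma,\delta)$ has vertex set all tuples $\langle\alpha,A_1,\dots,A_\delta\rangle$ with $\alpha\in A_1\subset A_2\subset\cdots\subset A_\delta\subseteq[m]$ and $|A_i|=r^{i-1}\cdot r^{\sigma}$ for $1\le i\le\delta$; two vertices $\langle\alpha,A_1,\dots,A_\delta\rangle$, $\langle\beta,B_1,\dots,B_\delta\rangle$ are adjacent iff $\alpha\neq\beta$, $\alpha\in B_1$, $\beta\in A_1$, and $A_i\subseteq B_{i+1}$, $B_i\subseteq A_{i+1}$ for all $1\le i\le\delta-1$. -}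

module Defs where

open import Data.Nat as ℕ using (ℕ; zero; suc)
open import Data.Integer as ℤ using (ℤ; +_; -[1+_])
open import Data.Rational using (ℚ; _/_; _<_; _≤_; _*_; _+_; 0ℚ; 1ℚ; ↥_; ↧ₙ_)
open import Data.Fin using (Fin; toℕ)
open import Data.Fin.Subset using (Subset; _∈_; _⊆_; _⊂_; ∣_∣)
open import Data.Product using (Σ; ∃; _×_)
open import Data.Sum using (_⊎_)
open import Relation.Binary.PropositionalEquality using (_≡_; _≢_)

ℕ→ℚ : ℕ → ℚ
ℕ→ℚ n = (+ n) / 1

powℚ : ℚ → ℕ → ℚ
powℚ q zero    = 1ℚ
powℚ q (suc n) = q * powℚ q n

-- r ^ z for natural base r and integer exponent z.
-- (For r = 0 and negative z the value is junk (0); it is only used with r ≥ 2.)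
powℤ : ℕ → ℤ → ℚ
powℤ r (+ n)          = ℕ→ℚ (r ℕ.^ n)
powℤ zero -[1+ n ]    = 0ℚ
powℤ (suc r) -[1+ n ] = powℚ ((+ 1) / suc r) (suc n)

-- Real numbers represented by their (open) lower Dedekind cuts:
-- a real y is given by the predicate  q ↦ (q < y)  on ℚ.

Cut : Set₁
Cut = ℚ → Set

ratCut : ℚ → Cut
ratCut x q = q < x

-- 2^x < y, for rationals x = n/d (d > 0) and y:  y > 0 and 2^n < y^d
Exp2Lt : ℚ → ℚ → Set
Exp2Lt x y = (0ℚ < y) × (powℤ 2 (↥ x) < powℚ y (↧ₙ x))

-- q < 2^x, for rationals q and x = n/d (d > 0):  q ≤ 0, or q > 0 and q^d < 2^n
LtExp2 : ℚ → ℚ → Set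
LtExp2 q x = (q ≤ 0ℚ) ⊎ ((0ℚ < q) × (powℚ q (↧ₙ x) < powℤ 2 (↥ x)))

exp2Cut : Cut → Cut
exp2Cut P q = ∃ λ t → P t × LtExp2 q t

-- lower cut of log₂ y:  q < log₂ y  iff  2^q < t < y for some rational t
-- (empty when y ≤ 0, i.e. when log₂ y is undefined)
log2Cut : Cut → Cut
log2Cut P q = ∃ λ t → Exp2Lt q t × P t

iterLog : ℕ → Cut → Cut
iterLog zero    P = P
iterLog (suc j) P = log2Cut (iterLog j P)

-- lower cut of the product x · y of two positive reals
mulCut : Cut → Cut → Cut
mulCut P Q q = ∃ λ c → ∃ λ l → (0ℚ < c) × (0ℚ < l) × P c × Q l × (q < c * l)

_≤ʳ_ : ℚ → Cut → Set
x ≤ʳ P = ∀ q → q < x → P q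

-- The graph W_r(m, σ, δ)
-- Index i : Fin δ stands for the paper's index i+1, so |A_{i+1}| = r^i · r^σ.

record Vertex (r m σ δ : ℕ) : Set where
  field
    α     : Fin m
    A     : Fin δ → Subset m
    size  : ∀ i → ∣ A i ∣ ≡ r ℕ.^ toℕ i ℕ.* r ℕ.^ σ
    α∈A₁  : ∀ i → toℕ i ≡ 0 → α ∈ A i
    chain : ∀ i j → toℕ j ≡ suc (toℕ i) → A i ⊂ A j

open Vertex public

Adj : ∀ {r m σ δ} → Vertex r m σ δ → Vertex r m σ δ → Set
Adj u v =
  (α u ≢ α v) ×
  (∀ i → toℕ i ≡ 0 → α u ∈ A v i) ×
  (∀ i → toℕ i ≡ 0 → α v ∈ A u i) ×
  (∀ i j → toℕ j ≡ suc (toℕ i) → (A u i ⊆ A v j) × (A v i ⊆ A u j))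

ProperColouring : (r m σ δ k : ℕ) → Set
ProperColouring r m σ δ k =
  Σ (Vertex r m σ δ → Fin k) λ c →
    ∀ u v → Adj u v → c u ≢ c v

χ≤ : (r m σ δ : ℕ) → Cut → Set
χ≤ r m σ δ y = ∃ λ k → ProperColouring r m σ δ k × (ℕ→ℚ k ≤ʳ y)

exponent : (r σ δ : ℕ) → ℚ
exponent r σ δ =
  ℕ→ℚ 2 + powℤ r ((+ σ) ℤ.+ (+ δ) ℤ.- (+ 2)) * ℕ→ℚ (suc r)

boundCut : (r σ δ m : ℕ) → Cut
boundCut r σ δ m =
  mulCut (exp2Cut (exp2Cut (ratCut (exponent r σ δ))))
         (iterLog (2 ℕ.* δ) (ratCut (ℕ→ℚ m)))

{-# OPTIONS --safe #-}

-- Write the elements of the universe [N] in binary, with lg N bits, and let T A be the set of levels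
-- at which the binary tree spanned by A ⊆ [N] branches.  Then T A ⊆ [lg N] is monotone in A, at most
-- as large as A, and contains, for any two distinct elements of A, a level at which they differ.
--
-- Start with the proper colouring of a vertex by its point α ∈ A₁.  In general let the colouring be by
-- a pair (g, x) with x a tuple of points of A₁; as adjacent vertices contain each other's points, tuples
-- x and x′ that differ do so at a level common to T A₁ and T B₁.  Listing T (T A₁) as a tuple of points of
-- [lg (lg N)], each level in T A₁ is determined by its own bits at these points, so the tuple and the
-- map from such bit patterns to the bits of x again form a proper colouring.  This step replaces
-- A₁ ⊂ ⋯ ⊂ A_δ by T (T A₂) ⊂ ⋯ ⊂ T (T A_δ) and costs two logarithms.
--
-- When one set is left, its last two logarithms are gained at once: a greedily chosen family of
-- O(log n) binary words of length n realises every bit assignment on boundedly many positions.  A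
-- vertex is coloured by g and a word agreeing with the bits of x at the levels in T A₁; by
-- the separation property two adjacent vertices cannot share both.
module Submission where

open import Defs
open import Data.Bool using (Bool; true; false; _∧_; if_then_else_)
open import Data.Fin using (Fin; zero; suc; toℕ; inject₁; inject≤; finToFun; funToFin; combine; remQuot)
open import Data.Fin.Properties as Fin
  using (inject≤-injective; funToFin-finToFin; finToFun-funToFin; combine-injective; remQuot-combine; toℕ-inject₁)
open import Data.Fin.Subset as Subset using (Subset; inside; outside; ∣_∣)
open import Data.Integer as ℤ using (-[1+_])
import Data.Integer.Properties as ℤ
open import Data.List as List using (List; []; _∷_; _++_; length; map; filter; cartesianProductWith; allFin)
open import Data.List.Membership.Propositional using (_∈_; find)
open import Data.List.Membership.Propositional.Properties
  using (∈-map⁺; ∈-map⁻; ∈-++⁺ˡ; ∈-++⁺ʳ; ∈-filter⁺; ∈-cartesianProductWith⁺; ∈-allFin)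
open import Data.List.Properties using (length-map; length-++; length-tabulate)
open import Data.List.Relation.Binary.Subset.Propositional using (_⊆_)
import Data.List.Relation.Binary.Subset.Propositional.Properties as ⊆
open import Data.List.Relation.Unary.All as All using (All; []; _∷_)
import Data.List.Relation.Unary.All.Properties as All
open import Data.List.Relation.Unary.Any as Any using (Any; here; there; index; any?)
open import Data.List.Relation.Unary.Any.Properties using (lookup-index)
open import Data.Maybe using (Maybe; just; nothing)
open import Data.Nat
import Data.Nat.Coprimality as Coprime
open import Data.Nat.Properties
open import Data.Nat.Tactic.RingSolver using (solve-∀)
open import Data.Product using (Σ; ∃; _×_; _,_; proj₁; proj₂)
open import Data.Rational as ℚ using (mkℚ; 0ℚ; 1ℚ; ½; ↥_; ↧ₙ_; *<*; *≤*)
import Data.Rational.Properties as ℚ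
open import Data.Sum using (_⊎_; inj₁; inj₂)
open import Data.Vec using (Vec; []; _∷_; here; there; lookup; replicate; _[_]≔_)
open import Data.Vec.Properties using (lookup∘update; lookup∘update′)
open import Function using (_∘_; id)
open import Relation.Binary.PropositionalEquality
open import Relation.Nullary using (Dec; yes; no; ¬_; does; contradiction; decidable-stable)

-- Universal families of binary words

Bit : Set
Bit = Fin 2

PartialWord : ℕ → Set
PartialWord = Vec (Maybe Bit)

Word : ℕ → Set
Word = Vec Bit

support : ∀ {n} → PartialWord n → ℕ
support []            = 0
support (nothing ∷ c) = support c
support (just _ ∷ c)  = suc (support c)

agrees : ∀ {n} → PartialWord n → Word n → Bool
agrees []            []      = true
agrees (nothing ∷ c) (b ∷ h) = agrees c h
agrees (just v ∷ c)  (b ∷ h) = does (v Fin.≟ b) ∧ agrees c h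

agrees-lookup : ∀ {n} (c : PartialWord n) h → agrees c h ≡ true →
                ∀ p {v} → lookup c p ≡ just v → lookup h p ≡ v
agrees-lookup (nothing ∷ c) (b ∷ h) eq (suc p) e = agrees-lookup c h eq p e
agrees-lookup (just v ∷ c)  (b ∷ h) eq p e with v Fin.≟ b
agrees-lookup (just v ∷ c)  (b ∷ h) eq zero    refl | yes v≡b = sym v≡b
agrees-lookup (just v ∷ c)  (b ∷ h) eq (suc p) e    | yes _   = agrees-lookup c h eq p e
agrees-lookup (just v ∷ c)  (b ∷ h) ()  p      e    | no _

Weighted : ℕ → Set
Weighted n = List (ℕ × PartialWord n)

mass : ∀ {n} → Weighted n → ℕ
mass []             = 0
mass ((w , _) ∷ cs) = w + mass cs

-- A uniformly random word agrees with `c` with probability `1 / 2 ^ support c`. The factor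
-- `2 ^ support c` cancels this, so each entry contributes `w` in expectation.
gain : ∀ {n} → Word n → Weighted n → ℕ
gain h []             = 0
gain h ((w , c) ∷ cs) = (if agrees c h then w * 2 ^ support c else 0) + gain h cs

-- Conditions on the first bit being `b`. Partial words contradicting `b` can no longer gain and are
-- dropped; matching ones lose one from their support and double their weight, which keeps their
-- gain.
restrict : ∀ {n} → Bit → Weighted (suc n) → Weighted n
restrict b []                        = []
restrict b ((w , nothing ∷ c) ∷ cs) = (w , c) ∷ restrict b cs
restrict b ((w , just v ∷ c) ∷ cs)  =
  if does (v Fin.≟ b) then (2 * w , c) ∷ restrict b cs else restrict b cs

-- The mass is the average of the two conditioned masses: an entry free in the first position
-- survives in both restrictions, any other entry in one of them with twice its weight.
mass-restrict : ∀ {n} (cs : Weighted (suc n)) →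
                mass cs + mass cs ≡ mass (restrict zero cs) + mass (restrict (suc zero) cs)
mass-restrict [] = refl
mass-restrict ((w , nothing ∷ c) ∷ cs) = begin
  (w + mass cs) + (w + mass cs)  ≡⟨ shuffle w (mass cs) ⟩
  (w + w) + (mass cs + mass cs)  ≡⟨ cong ((w + w) +_) (mass-restrict cs) ⟩
  (w + w) + (m₀ + m₁)            ≡⟨ shuffle′ w m₀ m₁ ⟩
  (w + m₀) + (w + m₁)            ∎
  where
  open ≡-Reasoning
  m₀ = mass (restrict zero cs)
  m₁ = mass (restrict (suc zero) cs)
  shuffle : ∀ a b → (a + b) + (a + b) ≡ (a + a) + (b + b)
  shuffle = solve-∀
  shuffle′ : ∀ a b c → (a + a) + (b + c) ≡ (a + b) + (a + c)
  shuffle′ = solve-∀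
mass-restrict ((w , just zero ∷ c) ∷ cs) = begin
  (w + mass cs) + (w + mass cs)  ≡⟨ shuffle w (mass cs) ⟩
  2 * w + (mass cs + mass cs)    ≡⟨ cong (2 * w +_) (mass-restrict cs) ⟩
  2 * w + (m₀ + m₁)              ≡⟨ +-assoc (2 * w) m₀ m₁ ⟨
  (2 * w + m₀) + m₁              ∎
  where
  open ≡-Reasoning
  m₀ = mass (restrict zero cs)
  m₁ = mass (restrict (suc zero) cs)
  shuffle : ∀ a b → (a + b) + (a + b) ≡ 2 * a + (b + b)
  shuffle = solve-∀
mass-restrict ((w , just (suc zero) ∷ c) ∷ cs) = begin
  (w + mass cs) + (w + mass cs)  ≡⟨ shuffle w (mass cs) ⟩
  2 * w + (mass cs + mass cs)    ≡⟨ cong (2 * w +_) (mass-restrict cs) ⟩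
  2 * w + (m₀ + m₁)              ≡⟨ shuffle′ (2 * w) m₀ m₁ ⟩
  m₀ + (2 * w + m₁)              ∎
  where
  open ≡-Reasoning
  m₀ = mass (restrict zero cs)
  m₁ = mass (restrict (suc zero) cs)
  shuffle : ∀ a b → (a + b) + (a + b) ≡ 2 * a + (b + b)
  shuffle = solve-∀
  shuffle′ : ∀ a b c → a + (b + c) ≡ b + (a + c)
  shuffle′ = solve-∀

gain-restrict : ∀ {n} b (h : Word n) cs → gain (b ∷ h) cs ≡ gain h (restrict b cs)
gain-restrict b h [] = refl
gain-restrict b h ((w , nothing ∷ c) ∷ cs) = cong (_ +_) (gain-restrict b h cs)
gain-restrict b h ((w , just v ∷ c) ∷ cs) with does (v Fin.≟ b)
... | false = gain-restrict b h cs
... | true with agrees c h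
...   | false = gain-restrict b h cs
...   | true  = cong₂ _+_ (weight w (2 ^ support c)) (gain-restrict b h cs)
  where
  weight : ∀ a b → a * (2 * b) ≡ (2 * a) * b
  weight = solve-∀

-- Conditional expectations: mass cs is the expected gain of a uniformly random word.
heavyWord : ∀ {n} (cs : Weighted n) → ∃ λ h → mass cs ≤ gain h cs
heavyWord {zero}  cs = [] , ≤-reflexive (all-agree cs)
  where
  all-agree : ∀ cs → mass cs ≡ gain [] cs
  all-agree [] = refl
  all-agree ((w , []) ∷ cs) = cong₂ _+_ (sym (*-identityʳ w)) (all-agree cs)
heavyWord {suc n} cs = choose (≤-total m₀ m₁)
  where
  m₀ = mass (restrict zero cs)
  m₁ = mass (restrict (suc zero) cs)

  half : ∀ {a b} → a + a ≤ b + b → a ≤ b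
  half {a} {b} p = ≮⇒≥ λ b<a → <⇒≱ (+-mono-< b<a b<a) p

  extend : ∀ b → mass cs ≤ mass (restrict b cs) → ∃ λ h → mass cs ≤ gain h cs
  extend b p = let h , q = heavyWord (restrict b cs) in
    b ∷ h , ≤-trans p (≤-trans q (≤-reflexive (sym (gain-restrict b h cs))))

  choose : m₀ ≤ m₁ ⊎ m₁ ≤ m₀ → ∃ λ h → mass cs ≤ gain h cs
  choose (inj₁ p) = extend (suc zero)
    (half (≤-trans (≤-reflexive (mass-restrict cs)) (+-monoˡ-≤ m₁ p)))
  choose (inj₂ p) = extend zero
    (half (≤-trans (≤-reflexive (mass-restrict cs)) (+-monoʳ-≤ m₀ p)))

hits : ∀ {n} → Word n → List (PartialWord n) → ℕ
hits h []       = 0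
hits h (c ∷ cs) = if agrees c h then suc (hits h cs) else hits h cs

missed : ∀ {n} → Word n → List (PartialWord n) → List (PartialWord n)
missed h []       = []
missed h (c ∷ cs) = if agrees c h then missed h cs else c ∷ missed h cs

hits+missed : ∀ {n} (h : Word n) cs → hits h cs + length (missed h cs) ≡ length cs
hits+missed h [] = refl
hits+missed h (c ∷ cs) with agrees c h
... | true  = cong suc (hits+missed h cs)
... | false = trans (+-suc (hits h cs) _) (cong suc (hits+missed h cs))

missed-All : ∀ {n} {P : PartialWord n → Set} (h : Word n) {cs} → All P cs → All P (missed h cs)
missed-All h [] = []
missed-All h {c ∷ _} (p ∷ ps) with agrees c h
... | true  = missed-All h ps
... | false = p ∷ missed-All h ps

SupportedBy : ℕ → ∀ {n} → PartialWord n → Set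
SupportedBy K c = support c ≤ K

-- With unit weights the mass counts the partial words, and each agreement gains at most `2 ^ K`, so
-- a heavy word hits at least a `2 ^ -K` fraction of them.
goodWord : ∀ {n K} (cs : List (PartialWord n)) → All (SupportedBy K) cs →
           ∃ λ h → length cs ≤ 2 ^ K * hits h cs
goodWord {n} {K} cs small =
  let h , p = heavyWord (unit cs) in
  h , ≤-trans (≤-reflexive (sym (mass-unit cs))) (≤-trans p (gain-unit h small))
  where
  unit : List (PartialWord n) → Weighted n
  unit = map (1 ,_)

  mass-unit : ∀ cs → mass (unit cs) ≡ length cs
  mass-unit []       = refl
  mass-unit (_ ∷ cs) = cong suc (mass-unit cs)

  gain-unit : ∀ h {cs} → All (SupportedBy K) cs → gain h (unit cs) ≤ 2 ^ K * hits h cs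
  gain-unit h [] = z≤n
  gain-unit h {c ∷ cs} (p ∷ ps) with agrees c h
  ... | false = gain-unit h ps
  ... | true  = ≤-trans
    (+-mono-≤ (≤-trans (≤-reflexive (*-identityˡ _)) (^-monoʳ-≤ 2 p)) (gain-unit h ps))
    (≤-reflexive (sym (*-suc (2 ^ K) (hits h cs))))

Cover : ∀ {n} → ℕ → List (PartialWord n) → Set
Cover {n} t cs = Σ (List (Word n)) λ H →
  length H ≤ t × All (λ c → Any (λ h → agrees c h ≡ true) H) cs

cover-∷ : ∀ {n t} (h : Word n) cs → Cover t (missed h cs) → Cover (suc t) cs
cover-∷ {n} h cs (H , |H|≤t , covered) = h ∷ H , s≤s |H|≤t , go cs covered
  where
  go : ∀ cs → All (λ c → Any (λ h → agrees c h ≡ true) H) (missed h cs) →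
       All (λ c → Any (λ h → agrees c h ≡ true) (h ∷ H)) cs
  go [] _ = []
  go (c ∷ cs) ps with agrees c h in eq
  go (c ∷ cs) ps       | true  = here eq ∷ go cs ps
  go (c ∷ cs) (p ∷ ps) | false = there p ∷ go cs ps

cover-singletons : ∀ {n t} (cs : List (PartialWord n)) → length cs ≤ t → Cover t cs
cover-singletons cs p = map fill cs , ≤-trans (≤-reflexive (length-map fill cs)) p , go cs
  where
  fill : ∀ {n} → PartialWord n → Word n
  fill []            = []
  fill (nothing ∷ c) = zero ∷ fill c
  fill (just v ∷ c)  = v ∷ fill c

  agrees-fill : ∀ {n} (c : PartialWord n) → agrees c (fill c) ≡ true
  agrees-fill []            = refl
  agrees-fill (nothing ∷ c) = agrees-fill c
  agrees-fill (just v ∷ c) with v Fin.≟ v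
  ... | yes _ = agrees-fill c
  ... | no v≢v = contradiction refl v≢v

  go : ∀ cs → All (λ c → Any (λ h → agrees c h ≡ true) (map fill cs)) cs
  go [] = []
  go (c ∷ cs) = here (agrees-fill c) ∷ All.map there (go cs)

-- While more than m partial words remain, each good word removes at least a 2^-K fraction of m.
cover-step : ∀ {n K t m} →
  (∀ (cs : List (PartialWord n)) → All (SupportedBy K) cs → length cs ≤ m → Cover t cs) →
  ∀ j (cs : List (PartialWord n)) → All (SupportedBy K) cs → 2 ^ K * length cs ≤ 2 ^ K * m + j * m → Cover (j + t) cs
cover-step {K = K} {m = m} base zero cs small p = base cs small
  (*-cancelˡ-≤ (2 ^ K) {{m^n≢0 2 K}} (≤-trans p (≤-reflexive (+-identityʳ _))))
cover-step {n} {K} {t} {m} base (suc j) cs small p with length cs ≤? m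
... | yes q = let H , |H|≤t , covered = base cs small q in
              H , ≤-trans |H|≤t (m≤n+m t (suc j)) , covered
... | no q  = cover-∷ h cs (cover-step base j (missed h cs) (missed-All h small) bound)
  where
  h = proj₁ (goodWord cs small)
  D = 2 ^ K
  open ≤-Reasoning
  bound : D * length (missed h cs) ≤ D * m + j * m
  bound = +-cancelʳ-≤ m _ _ (begin
    D * length (missed h cs) + m                ≤⟨ +-monoʳ-≤ _ (≰⇒≥ q) ⟩
    D * length (missed h cs) + length cs        ≤⟨ +-monoʳ-≤ _ (proj₂ (goodWord cs small)) ⟩
    D * length (missed h cs) + D * hits h cs    ≡⟨ *-distribˡ-+ D _ _ ⟨
    D * (length (missed h cs) + hits h cs)      ≡⟨ cong (D *_) (trans (+-comm _ (hits h cs)) (hits+missed h cs)) ⟩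
    D * length cs                               ≤⟨ p ⟩
    D * m + (m + j * m)                         ≡⟨ shuffle (D * m) m (j * m) ⟩
    (D * m + j * m) + m                         ∎)
    where
    shuffle : ∀ a b c → a + (b + c) ≡ (a + c) + b
    shuffle = solve-∀

-- Halving the bound `2 ^ a` on the number of partial words left takes at most `2 ^ K` good words.
-- After `a` halvings at most one partial word is left, which costs the final `1`.
cover : ∀ {n K} a (cs : List (PartialWord n)) → All (SupportedBy K) cs →
        length cs ≤ 2 ^ a → Cover (a * 2 ^ K + 1) cs
cover zero    cs small p = cover-singletons cs p
cover {K = K} (suc a) cs small p =
  subst (λ t → Cover t cs) (sym (+-assoc (2 ^ K) (a * 2 ^ K) 1))
    (cover-step (cover a) (2 ^ K) cs small
      (≤-trans (*-monoʳ-≤ (2 ^ K) p) (≤-reflexive (double (2 ^ K) (2 ^ a)))))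
  where
  double : ∀ d m → d * (2 * m) ≡ d * m + d * m
  double = solve-∀

-- Enumeration of partial words of bounded support

partialWords : ∀ n → ℕ → List (PartialWord n)
partialWords zero    K       = [] ∷ []
partialWords (suc n) zero    = map (nothing ∷_) (partialWords n zero)
partialWords (suc n) (suc K) =
  map (nothing ∷_) (partialWords n (suc K)) ++
  (map (just zero ∷_) (partialWords n K) ++ map (just (suc zero) ∷_) (partialWords n K))

partialWords-support : ∀ n K → All (SupportedBy K) (partialWords n K)
partialWords-support zero    K       = z≤n ∷ []
partialWords-support (suc n) zero    = All.map⁺ (partialWords-support n zero)
partialWords-support (suc n) (suc K) =
  All.++⁺ (All.map⁺ (partialWords-support n (suc K)))
    (All.++⁺ (All.map⁺ (All.map s≤s (partialWords-support n K)))
             (All.map⁺ (All.map s≤s (partialWords-support n K))))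

∈-partialWords : ∀ {n} K (c : PartialWord n) → support c ≤ K → c ∈ partialWords n K
∈-partialWords K       []                      p = here refl
∈-partialWords zero    (nothing ∷ c)           p = ∈-map⁺ _ (∈-partialWords zero c p)
∈-partialWords (suc K) (nothing ∷ c)           p = ∈-++⁺ˡ (∈-map⁺ _ (∈-partialWords (suc K) c p))
∈-partialWords {suc n} (suc K) (just zero ∷ c)       (s≤s p) =
  ∈-++⁺ʳ (map (nothing ∷_) (partialWords n (suc K)))
    (∈-++⁺ˡ (∈-map⁺ _ (∈-partialWords K c p)))
∈-partialWords {suc n} (suc K) (just (suc zero) ∷ c) (s≤s p) =
  ∈-++⁺ʳ (map (nothing ∷_) (partialWords n (suc K)))
    (∈-++⁺ʳ (map (just zero ∷_) (partialWords n K)) (∈-map⁺ _ (∈-partialWords K c p)))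

-- A partial word arises from `K` choices, each of a position with its bit or of nothing, with
-- `2 * n + 1` options apiece. With `q = 2 * n + 1` the induction uses `q ^ (K + 1) + 2 * q ^ K = (q
-- + 2) * q ^ K`.
length-partialWords : ∀ n K → length (partialWords n K) ≤ suc (2 * n) ^ K
length-partialWords zero    K    = ≤-reflexive (sym (^-zeroˡ K))
length-partialWords (suc n) zero =
  ≤-trans (≤-reflexive (length-map (nothing ∷_) (partialWords n zero))) (length-partialWords n zero)
length-partialWords (suc n) (suc K) = begin
  length (map (nothing ∷_) U ++ (map (just zero ∷_) W ++ map (just (suc zero) ∷_) W))
    ≡⟨ length-++ (map (nothing ∷_) U) ⟩
  length (map (nothing ∷_) U) + length (map (just zero ∷_) W ++ map (just (suc zero) ∷_) W)
    ≡⟨ cong (length (map (nothing ∷_) U) +_) (length-++ (map (just zero ∷_) W)) ⟩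
  length (map (nothing ∷_) U) + (length (map (just zero ∷_) W) + length (map (just (suc zero) ∷_) W))
    ≡⟨ cong₂ _+_ (length-map _ U) (cong₂ _+_ (length-map _ W) (length-map _ W)) ⟩
  length U + (length W + length W)
    ≤⟨ +-mono-≤ (length-partialWords n (suc K)) (+-mono-≤ (length-partialWords n K) (length-partialWords n K)) ⟩
  q * q ^ K + (q ^ K + q ^ K)
    ≡⟨ collect q (q ^ K) ⟩
  (2 + q) * q ^ K
    ≤⟨ *-monoʳ-≤ (2 + q) (^-monoˡ-≤ K (m≤n+m q 2)) ⟩
  (2 + q) * (2 + q) ^ K
    ≡⟨ cong (_^ suc K) (shift n) ⟩
  suc (2 * suc n) ^ suc K ∎
  where
  open ≤-Reasoning
  q = suc (2 * n)
  U = partialWords n (suc K)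
  W = partialWords n K
  collect : ∀ a b → a * b + (b + b) ≡ (2 + a) * b
  collect = solve-∀
  shift : ∀ n → 2 + suc (2 * n) ≡ suc (2 * suc n)
  shift = solve-∀

restrictTo : ∀ {n} → (Fin n → Bit) → List (Fin n) → PartialWord n
restrictTo f []       = replicate _ nothing
restrictTo f (p ∷ ps) = restrictTo f ps [ p ]≔ just (f p)

support-restrictTo : ∀ {n} (f : Fin n → Bit) ps → support (restrictTo f ps) ≤ length ps
support-restrictTo {n} f [] = ≤-reflexive (support-empty n)
  where
  support-empty : ∀ n → support (replicate n nothing) ≡ 0
  support-empty zero    = refl
  support-empty (suc n) = support-empty n
support-restrictTo f (p ∷ ps) =
  ≤-trans (support-update (restrictTo f ps) p) (s≤s (support-restrictTo f ps))
  where
  support-update : ∀ {n v} (c : PartialWord n) p → support (c [ p ]≔ just v) ≤ suc (support c)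
  support-update (nothing ∷ c) zero    = ≤-refl
  support-update (just _ ∷ c)  zero    = n≤1+n _
  support-update (nothing ∷ c) (suc p) = support-update c p
  support-update (just _ ∷ c)  (suc p) = s≤s (support-update c p)

lookup-restrictTo : ∀ {n} (f : Fin n → Bit) {ps p} → p ∈ ps → lookup (restrictTo f ps) p ≡ just (f p)
lookup-restrictTo f {q ∷ ps} {p} p∈ with p Fin.≟ q
... | yes refl = lookup∘update p (restrictTo f ps) (just (f p))
lookup-restrictTo f {q ∷ ps} {p} (here p≡q)  | no p≢q = contradiction p≡q p≢q
lookup-restrictTo f {q ∷ ps} {p} (there p∈)  | no p≢q =
  trans (lookup∘update′ p≢q (restrictTo f ps) (just (f q))) (lookup-restrictTo f p∈)

-- An assignment on at most `K` positions is a partial word of support at most `K`, so a cover of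
-- all of these is universal. Their number enters only through its logarithm `a`.
universalFamily : ∀ n K a → suc (2 * n) ^ K ≤ 2 ^ a →
  Σ ℕ λ t → t ≤ a * 2 ^ K + 1 ×
    Σ (Fin t → Fin n → Bit) λ H →
      ∀ (f : Fin n → Bit) ps → length ps ≤ K → ∃ λ j → ∀ {p} → p ∈ ps → H j p ≡ f p
universalFamily n K a count =
  let H , |H|≤ , covered = cover {K = K} a (partialWords n K) (partialWords-support n K)
                             (≤-trans (length-partialWords n K) count)
  in length H , |H|≤ , (λ j → lookup (List.lookup H j)) , λ f ps p≤K →
    let found = All.lookup covered
          (∈-partialWords K (restrictTo f ps) (≤-trans (support-restrictTo f ps) p≤K))
    in index found , λ {p} p∈ →
      agrees-lookup (restrictTo f ps) _ (lookup-index found) p (lookup-restrictTo f p∈)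

-- Branching levels

-- lg n = max(1, ⌈log₂ n⌉); being a successor, it always gives an inhabited type Fin (lg n).
lg-1 : ℕ → ℕ
lg-1 zero    = 0
lg-1 (suc n) with suc n ≤? 2 ^ suc (lg-1 n)
... | yes _ = lg-1 n
... | no  _ = suc (lg-1 n)

lg : ℕ → ℕ
lg n = suc (lg-1 n)

n≤2^lg : ∀ n → n ≤ 2 ^ lg n
n≤2^lg zero    = z≤n
n≤2^lg (suc n) with suc n ≤? 2 ^ suc (lg-1 n)
... | yes p = p
... | no  _ = ≤-trans (+-mono-≤ (m^n>0 2 (lg n)) (n≤2^lg n))
                      (+-monoʳ-≤ (2 ^ lg n) (m≤m+n _ 0))

-- The condition `1 ≤ p` is due to `lg` being at least 1 even for `n ≤ 1`.
lg-minimal : ∀ n p → 1 ≤ p → suc p ≤ lg n → 2 ^ p < n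
lg-minimal zero    (suc p) _ (s≤s ())
lg-minimal (suc n) p 1≤p q with suc n ≤? 2 ^ suc (lg-1 n)
... | yes _ = m≤n⇒m≤1+n (lg-minimal n p 1≤p q)
... | no  r = ≤-<-trans (^-monoʳ-≤ 2 (s≤s⁻¹ q)) (≰⇒> r)

iterLg : ℕ → ℕ → ℕ
iterLg zero    n = n
iterLg (suc j) n = lg (iterLg j n)

iterLg-lg : ∀ j n → iterLg j (lg n) ≡ lg (iterLg j n)
iterLg-lg zero    n = refl
iterLg-lg (suc j) n = cong lg (iterLg-lg j n)

funToFin-cong : ∀ {m n} {f g : Fin m → Fin n} → (∀ i → f i ≡ g i) → funToFin f ≡ funToFin g
funToFin-cong {zero}  e = refl
funToFin-cong {suc m} e = cong₂ combine (e zero) (funToFin-cong (e ∘ suc))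

finToFun-injective : ∀ {m n} (x y : Fin (m ^ n)) → (∀ i → finToFun {m} {n} x i ≡ finToFun {m} {n} y i) → x ≡ y
finToFun-injective {m} {n} x y e = begin
  x                          ≡⟨ funToFin-finToFin {n} {m} x ⟨
  funToFin {n} {m} (finToFun x)  ≡⟨ funToFin-cong e ⟩
  funToFin {n} {m} (finToFun y)  ≡⟨ funToFin-finToFin {n} {m} y ⟩
  y                          ∎
  where open ≡-Reasoning

bit : ∀ {N} → Fin N → Fin (lg N) → Bit
bit {N} x = finToFun (inject≤ x (n≤2^lg N))

bit-injective : ∀ {N} (x y : Fin N) → (∀ i → bit x i ≡ bit y i) → x ≡ y
bit-injective {N} x y e =
  inject≤-injective (n≤2^lg N) (n≤2^lg N) x y (finToFun-injective {2} {lg N} _ _ e)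

module _ {X : Set} where

  split : ∀ {d} → (X → Fin (suc d) → Bit) → Bit → List X → List X
  split c b = filter (λ x → c x zero Fin.≟ b)

  branching : ∀ {d} → List X → List X → List (Fin (suc d))
  branching (_ ∷ _) (_ ∷ _) = zero ∷ []
  branching _       _       = []

  -- The levels at which the binary tree spanned by the codes of A branches.
  levels : ∀ {d} → (X → Fin d → Bit) → List X → List (Fin d)
  levels {zero}  c A = []
  levels {suc d} c A =
    branching A₀ A₁ ++ map suc (levels (λ x → c x ∘ suc) A₀ ++ levels (λ x → c x ∘ suc) A₁)
    where
    A₀ = split c zero A
    A₁ = split c (suc zero) A

  length-split : ∀ {d} (c : X → Fin (suc d) → Bit) A →
                 length (split c zero A) + length (split c (suc zero) A) ≡ length A
  length-split c [] = refl
  length-split c (x ∷ A) with c x zero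
  ... | zero     = cong suc (length-split c A)
  ... | suc zero = trans (+-suc _ _) (cong suc (length-split c A))

  -- A binary tree has fewer branching nodes than leaves. In the induction, a new branching level
  -- arises only when both halves are nonempty, and then the second `pred` pays for it.
  length-levels : ∀ {d} (c : X → Fin d → Bit) A → length (levels c A) ≤ pred (length A)
  length-levels {zero}  c A = z≤n
  length-levels {suc d} c A = begin
    length (branching {d} A₀ A₁ ++ map suc (L₀ ++ L₁))     ≡⟨ length-++ (branching {d} A₀ A₁) ⟩
    length (branching {d} A₀ A₁) + length (map suc (L₀ ++ L₁))
      ≡⟨ cong (length (branching {d} A₀ A₁) +_) (trans (length-map suc (L₀ ++ L₁)) (length-++ L₀)) ⟩
    length (branching {d} A₀ A₁) + (length L₀ + length L₁)
      ≤⟨ +-monoʳ-≤ (length (branching {d} A₀ A₁)) (+-mono-≤ (length-levels c′ A₀) (length-levels c′ A₁)) ⟩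
    length (branching {d} A₀ A₁) + (pred (length A₀) + pred (length A₁))
      ≤⟨ merge A₀ A₁ ⟩
    pred (length A₀ + length A₁)                       ≡⟨ cong pred (length-split c A) ⟩
    pred (length A)                                    ∎
    where
    open ≤-Reasoning
    c′ : X → Fin d → Bit
    c′ x = c x ∘ suc
    A₀ = split c zero A
    A₁ = split c (suc zero) A
    L₀ = levels c′ A₀
    L₁ = levels c′ A₁
    merge : ∀ A B → length (branching {d} A B) + (pred (length A) + pred (length B)) ≤
            pred (length A + length B)
    merge []      B       = ≤-refl
    merge (_ ∷ A) []      = ≤-reflexive (trans (+-identityʳ _) (sym (+-identityʳ _)))
    merge (_ ∷ A) (_ ∷ B) = ≤-reflexive (sym (+-suc (length A) (length B)))

  zero∈branching : ∀ {d x y} {A B} → x ∈ A → y ∈ B → zero ∈ branching {d} A B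
  zero∈branching {A = _ ∷ _} {_ ∷ _} _ _ = here refl

  branching-mono : ∀ {d A A′ B B′} → A ⊆ A′ → B ⊆ B′ → branching {d} A B ⊆ branching A′ B′
  branching-mono {A = _ ∷ _} {B = _ ∷ _} p q (here refl) = zero∈branching (p (here refl)) (q (here refl))

  split-mono : ∀ {d} (c : X → Fin (suc d) → Bit) b {A B} → A ⊆ B → split c b A ⊆ split c b B
  split-mono c b = ⊆.filter⁺′ (λ x → c x zero Fin.≟ b) (λ x → c x zero Fin.≟ b) id

  levels-mono : ∀ {d} (c : X → Fin d → Bit) {A B} → A ⊆ B → levels c A ⊆ levels c B
  levels-mono {suc d} c p =
    ⊆.++⁺ (branching-mono {d} p₀ p₁)
      (⊆.map⁺ suc (⊆.++⁺ (levels-mono (λ x → c x ∘ suc) p₀) (levels-mono (λ x → c x ∘ suc) p₁)))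
    where
    p₀ = split-mono c zero p
    p₁ = split-mono c (suc zero) p

  -- The witness is the first level at which the two codes differ: until then `x` and `y` descend
  -- into the same half, and there they lie in different halves, so the tree branches. The level `i`
  -- ensures that the descent meets a difference.
  levels-separate : ∀ {d} (c : X → Fin d → Bit) {x y A} → x ∈ A → y ∈ A →
                    ∀ i → c x i ≢ c y i → ∃ λ ℓ → ℓ ∈ levels c A × c x ℓ ≢ c y ℓ
  levels-separate {suc d} c {x} {y} {A} x∈A y∈A i cx≢cy = go i cx≢cy (c x zero) (c y zero) refl refl
    where
    c′ : X → Fin d → Bit
    c′ z = c z ∘ suc
    A₀ = split c zero A
    A₁ = split c (suc zero) A

    in-split : ∀ {z b} → z ∈ A → c z zero ≡ b → z ∈ split c b A
    in-split {b = b} = ∈-filter⁺ (λ z → c z zero Fin.≟ b)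

    go : ∀ i → c x i ≢ c y i → ∀ bx by → c x zero ≡ bx → c y zero ≡ by →
         ∃ λ ℓ → ℓ ∈ levels c A × c x ℓ ≢ c y ℓ
    go i ne zero (suc zero) ex ey =
      zero , ∈-++⁺ˡ (zero∈branching (in-split x∈A ex) (in-split y∈A ey)) ,
      λ e → contradiction (trans (sym ex) (trans e ey)) λ ()
    go i ne (suc zero) zero ex ey =
      zero , ∈-++⁺ˡ (zero∈branching (in-split y∈A ey) (in-split x∈A ex)) ,
      λ e → contradiction (trans (sym ex) (trans e ey)) λ ()
    go zero ne zero       zero       ex ey = contradiction (trans ex (sym ey)) ne
    go zero ne (suc zero) (suc zero) ex ey = contradiction (trans ex (sym ey)) ne
    go (suc i) ne zero zero ex ey =
      let ℓ , ℓ∈ , ne′ = levels-separate c′ (in-split x∈A ex) (in-split y∈A ey) i ne in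
      suc ℓ , ∈-++⁺ʳ (branching A₀ A₁) (∈-map⁺ suc (∈-++⁺ˡ ℓ∈)) , ne′
    go (suc i) ne (suc zero) (suc zero) ex ey =
      let ℓ , ℓ∈ , ne′ = levels-separate c′ (in-split x∈A ex) (in-split y∈A ey) i ne in
      suc ℓ , ∈-++⁺ʳ (branching A₀ A₁) (∈-map⁺ suc (∈-++⁺ʳ (levels c′ A₀) ℓ∈)) , ne′

-- The extra level `zero` makes the list nonempty, so that padding by `zero` stays inside it. It
-- uses up the 1 saved in `length-levels`.
branchLevels : ∀ {N} → List (Fin N) → List (Fin (lg N))
branchLevels A = zero ∷ levels bit A

length-branchLevels : ∀ {N s} (A : List (Fin N)) → 1 ≤ s → length A ≤ s → length (branchLevels A) ≤ s
length-branchLevels {N} {suc s} A _ p = s≤s (≤-trans (length-levels bit A) (pred-mono-≤ p))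

branchLevels-mono : ∀ {N} {A B : List (Fin N)} → A ⊆ B → branchLevels A ⊆ branchLevels B
branchLevels-mono p = ⊆.∷⁺ʳ zero (levels-mono bit p)

branchLevels-separate : ∀ {N} {x y : Fin N} {A} → x ∈ A → y ∈ A → x ≢ y →
                        ∃ λ ℓ → ℓ ∈ branchLevels A × bit x ℓ ≢ bit y ℓ
branchLevels-separate {N} {x} {y} x∈A y∈A x≢y =
  let i , ne = Fin.¬∀⟶∃¬ (lg N) (λ i → bit x i ≡ bit y i) (λ i → bit x i Fin.≟ bit y i)
                 (x≢y ∘ bit-injective x y)
      ℓ , ℓ∈ , ne′ = levels-separate bit x∈A y∈A i ne
  in ℓ , there ℓ∈ , ne′

-- A separating level of the pair `x`, `y` alone belongs, by monotonicity, to the branching levels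
-- of every set containing both.
branchLevels-separate₂ : ∀ {N} {x y : Fin N} {A B} → x ∈ A → y ∈ A → x ∈ B → y ∈ B → x ≢ y →
                         ∃ λ ℓ → ℓ ∈ branchLevels A × ℓ ∈ branchLevels B × bit x ℓ ≢ bit y ℓ
branchLevels-separate₂ {N} {x} {y} x∈A y∈A x∈B y∈B x≢y =
  let ℓ , ℓ∈ , ne = branchLevels-separate {A = x ∷ y ∷ []} (here refl) (there (here refl)) x≢y
  in ℓ , branchLevels-mono (pair⊆ x∈A y∈A) ℓ∈ , branchLevels-mono (pair⊆ x∈B y∈B) ℓ∈ , ne
  where
  pair⊆ : ∀ {A} → x ∈ A → y ∈ A → (x ∷ y ∷ []) ⊆ A
  pair⊆ p q (here refl)         = p
  pair⊆ p q (there (here refl)) = q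

-- Reducing the number of sets

-- Turns a list of length at most `k` into a `k`-tuple, padded with `d`.
nth : ∀ {A : Set} → A → List A → ∀ {k} → Fin k → A
nth d []       i       = d
nth d (a ∷ as) zero    = a
nth d (a ∷ as) (suc i) = nth d as i

nth-∈ : ∀ {A : Set} {d : A} {as} → d ∈ as → ∀ {k} (i : Fin k) → nth d as i ∈ as
nth-∈ {A} {d} {as} d∈as = λ i → reduce (go as i)
  where
  go : ∀ as {k} (i : Fin k) → nth d as i ∈ d ∷ as
  go []       i       = here refl
  go (a ∷ as) zero    = there (here refl)
  go (a ∷ as) (suc i) with go as i
  ... | here p  = here p
  ... | there p = there (there p)
  reduce : ∀ {x} → x ∈ d ∷ as → x ∈ as
  reduce (here refl) = d∈as
  reduce (there p)   = p

∈-nth : ∀ {A : Set} {d x : A} {as k} → length as ≤ k → x ∈ as → ∃ λ (i : Fin k) → nth d as i ≡ x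
∈-nth {k = suc k} p       (here refl) = zero , refl
∈-nth {k = suc k} (s≤s p) (there x∈)  = let i , e = ∈-nth p x∈ in suc i , e

-- A section of `f` over its values on `as`; if `f` is injective on `as`, it recovers the argument
-- from the value.
firstWith : ∀ {A C : Set} → (∀ (a b : C) → Dec (a ≡ b)) → A → (A → C) → C → List A → A
firstWith _≟′_ d f c as with any? (λ a → f a ≟′ c) as
... | yes p = proj₁ (find p)
... | no _  = d

firstWith-spec : ∀ {A C : Set} (_≟′_ : ∀ (a b : C) → Dec (a ≡ b)) d (f : A → C) {a as} → a ∈ as →
                 let b = firstWith _≟′_ d f (f a) as in b ∈ as × f b ≡ f a
firstWith-spec _≟′_ d f {a} {as} a∈as with any? (λ b → f b ≟′ f a) as
... | yes p = proj₂ (find p)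
... | no ¬p = contradiction (Any.map (λ e → cong f (sym e)) a∈as) ¬p

funToFin-injective : ∀ {m n} {f g : Fin m → Fin n} → funToFin f ≡ funToFin g → ∀ i → f i ≡ g i
funToFin-injective {m} {n} {f} {g} e i =
  trans (sym (finToFun-funToFin f i)) (trans (cong (λ x → finToFun {n} {m} x i) e) (finToFun-funToFin g i))

length-cartesianProductWith : ∀ {A B C : Set} (f : A → B → C) as bs →
                              length (cartesianProductWith f as bs) ≡ length as * length bs
length-cartesianProductWith f []       bs = refl
length-cartesianProductWith f (a ∷ as) bs =
  trans (length-++ (map (f a) bs))
        (cong₂ _+_ (length-map (f a) bs) (length-cartesianProductWith f as bs))

Colouring : {V : Set} → (V → V → Set) → ℕ → Set
Colouring {V} _~_ k = Σ (V → Fin k) λ c → ∀ u v → u ~ v → c u ≢ c v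

module _ {V : Set} (_~_ : V → V → Set) (~-sym : ∀ u v → u ~ v → v ~ u) where

  -- The sets of a vertex of W_r, transported to the universe Fin N after some iterations of
  -- branchLevels, together with a proper colouring by pairs (colour, points).
  record Stage (r n N k G s : ℕ) : Set where
    field
      sets       : Fin (suc n) → V → List (Fin N)
      size≤      : ∀ i u → length (sets i u) ≤ r ^ toℕ i * s
      nested     : ∀ i u → sets (inject₁ i) u ⊆ sets (suc i) u
      interlaced : ∀ {u v} → u ~ v → ∀ i → sets (inject₁ i) u ⊆ sets (suc i) v
      colour     : V → Fin G
      points     : V → Fin k → Fin N
      points∈    : ∀ u i → points u i ∈ sets zero u
      points∈′   : ∀ {u v} → u ~ v → ∀ i → points u i ∈ sets zero v
      proper     : ∀ {u v} → u ~ v → colour u ≡ colour v → ¬ (∀ i → points u i ≡ points v i)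

    size₀ : ∀ u → length (sets zero u) ≤ s
    size₀ u = ≤-trans (size≤ zero u) (≤-reflexive (*-identityˡ s))

    -- The points of adjacent `u` and `v` all lie in both first sets, so two differing points would
    -- disagree at a common branching level. Agreement at all such levels thus makes the points
    -- equal, against `proper`.
    separate : ∀ {u v} → u ~ v → colour u ≡ colour v →
      (∀ {ℓ} i → ℓ ∈ branchLevels (sets zero u) → ℓ ∈ branchLevels (sets zero v) →
        bit (points u i) ℓ ≡ bit (points v i) ℓ) → ∀ {A : Set} → A
    separate {u} {v} adj same agree = contradiction points-agree (proper adj same)
      where
      points-agree : ∀ i → points u i ≡ points v i
      points-agree i = decidable-stable (_ Fin.≟ _) λ ne →
        let ℓ , ℓ∈u , ℓ∈v , bits≢ = branchLevels-separate₂
              (points∈ u i) (points∈′ (~-sym u v adj) i) (points∈′ adj i) (points∈ v i) ne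
        in bits≢ (agree i ℓ∈u ℓ∈v)

  -- The first set is dropped and survives as the `s` new points. The new colour also records the
  -- map from the `2 ^ s` bit patterns at these points to the `2 ^ k` tuples of bits of the old
  -- points.
  advance : ∀ {r n N k G s} → 1 ≤ r → 1 ≤ s → Stage r (suc n) N k G s →
            Stage r n (lg (lg N)) s (G * (2 ^ k) ^ (2 ^ s)) (r * s)
  advance {r} {n} {N} {k} {G} {s} 1≤r 1≤s S = record
    { sets       = λ i → TT ∘ sets (suc i)
    ; size≤      = λ i u →
        let pos = *-mono-≤ {1} {r ^ suc (toℕ i)} {1} (m^n>0 r {{>-nonZero 1≤r}} (suc (toℕ i))) 1≤s in
        ≤-trans (length-branchLevels (branchLevels (sets (suc i) u)) pos
                  (length-branchLevels (sets (suc i) u) pos (size≤ (suc i) u)))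
                (≤-reflexive (regroup r (r ^ toℕ i) s))
    ; nested     = λ i u → TT-mono (nested (suc i) u)
    ; interlaced = λ adj i → TT-mono (interlaced adj (suc i))
    ; colour     = λ u → combine (colour u) (funToFin (palette u))
    ; points     = points′
    -- The new points come from the dropped set, which lies in the second set of the same vertex and
    -- in that of every neighbour.
    ; points∈    = λ u i → TT-mono (nested zero u) (points′∈ u i)
    ; points∈′   = λ {u} adj i → TT-mono (interlaced adj zero) (points′∈ u i)
    ; proper     = proper′
    }
    where
    open Stage S

    regroup : ∀ a b c → a * b * c ≡ b * (a * c)
    regroup = solve-∀

    TT : List (Fin N) → List (Fin (lg (lg N)))
    TT = branchLevels ∘ branchLevels

    TT-mono : ∀ {A B} → A ⊆ B → TT A ⊆ TT B
    TT-mono = branchLevels-mono ∘ branchLevels-mono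

    points′ : V → Fin s → Fin (lg (lg N))
    points′ u = nth zero (TT (sets zero u))

    points′∈ : ∀ u i → points′ u i ∈ TT (sets zero u)
    points′∈ u = nth-∈ (here refl)

    pattern′ : V → Fin (lg N) → Fin (2 ^ s)
    pattern′ u ℓ = funToFin (λ i → bit ℓ (points′ u i))

    levelWith : V → Fin (2 ^ s) → Fin (lg N)
    levelWith u p = firstWith Fin._≟_ zero (pattern′ u) p (branchLevels (sets zero u))

    palette : V → Fin (2 ^ s) → Fin (2 ^ k)
    palette u p = funToFin (λ i → bit (points u i) (levelWith u p))

    -- Two distinct levels in `branchLevels (sets zero u)` differ in a bit at some point of
    -- `TT (sets zero u)`, and all these points are among the `points′ u`; hence the pattern
    -- determines the level.
    levelWith-pattern : ∀ u {ℓ} → ℓ ∈ branchLevels (sets zero u) → levelWith u (pattern′ u ℓ) ≡ ℓ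
    levelWith-pattern u {ℓ} ℓ∈ = decidable-stable (_ Fin.≟ _) λ ne →
      let ℓ′∈ , same = firstWith-spec Fin._≟_ zero (pattern′ u) ℓ∈
          p , p∈ , bits≢ = branchLevels-separate ℓ′∈ ℓ∈ ne
          i , e = ∈-nth {d = zero} (length-branchLevels (branchLevels (sets zero u)) 1≤s
                                 (length-branchLevels (sets zero u) 1≤s (size₀ u))) p∈
      in bits≢ (subst (λ q → bit (levelWith u (pattern′ u ℓ)) q ≡ bit ℓ q) e
                 (funToFin-injective same i))

    proper′ : ∀ {u v} → u ~ v →
      combine (colour u) (funToFin (palette u)) ≡ combine (colour v) (funToFin (palette v)) →
      ¬ (∀ i → points′ u i ≡ points′ v i)
    proper′ {u} {v} adj same points≡ =
      let colour≡ , palette≡ = combine-injective _ _ _ _ same in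
      separate adj colour≡ λ {ℓ} i ℓ∈u ℓ∈v →
        -- Equal new points give `ℓ` the same pattern at `u` and `v`, so the equal palettes are read
        -- at the same argument.
        let pattern≡ = funToFin-cong (λ j → cong (bit ℓ) (points≡ j)) in begin
        bit (points u i) ℓ                            ≡⟨ cong (bit (points u i)) (levelWith-pattern u ℓ∈u) ⟨
        bit (points u i) (levelWith u (pattern′ u ℓ))
          ≡⟨ funToFin-injective (funToFin-injective palette≡ (pattern′ u ℓ)) i ⟩
        bit (points v i) (levelWith v (pattern′ u ℓ)) ≡⟨ cong (bit (points v i) ∘ levelWith v) pattern≡ ⟩
        bit (points v i) (levelWith v (pattern′ v ℓ)) ≡⟨ cong (bit (points v i)) (levelWith-pattern v ℓ∈v) ⟩
        bit (points v i) ℓ                            ∎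
      where open ≡-Reasoning

  -- The bits of all `k` points form one word of length `lg N * k`, of which only the at most
  -- `s * k` cells at branching levels matter. A member of a universal family reproduces these, and
  -- its index replaces the points.
  finish : ∀ {r N k G s} a → 1 ≤ s → suc (2 * (lg N * k)) ^ (s * k) ≤ 2 ^ a → Stage r 0 N k G s →
           ∃ λ t → t ≤ a * 2 ^ (s * k) + 1 × Colouring _~_ (G * t)
  finish {r} {N} {k} {G} {s} a 1≤s count S = t , t≤ , c , c-proper
    where
    open Stage S
    family = universalFamily (lg N * k) (s * k) a count
    t  = proj₁ family
    t≤ = proj₁ (proj₂ family)
    H  = proj₁ (proj₂ (proj₂ family))

    value : V → Fin (lg N * k) → Bit
    value u p = let ℓ , i = remQuot k p in bit (points u i) ℓ

    cells : V → List (Fin (lg N * k))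
    cells u = cartesianProductWith combine (branchLevels (sets zero u)) (allFin k)

    cells-length : ∀ u → length (cells u) ≤ s * k
    cells-length u = ≤-trans (≤-reflexive (length-cartesianProductWith combine (branchLevels (sets zero u)) (allFin k)))
      (*-mono-≤ (length-branchLevels (sets zero u) 1≤s (size₀ u)) (≤-reflexive (length-tabulate {n = k} id)))

    extends : ∀ u → ∃ λ j → ∀ {p} → p ∈ cells u → H j p ≡ value u p
    extends u = proj₂ (proj₂ (proj₂ family)) (value u) (cells u) (cells-length u)

    word : V → Fin t
    word u = proj₁ (extends u)

    word-bit : ∀ u {ℓ} i → ℓ ∈ branchLevels (sets zero u) → H (word u) (combine ℓ i) ≡ bit (points u i) ℓ
    word-bit u {ℓ} i ℓ∈ = trans
      (proj₂ (extends u) (∈-cartesianProductWith⁺ combine ℓ∈ (∈-allFin i)))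
      (cong (λ (ℓ′ , i′) → bit (points u i′) ℓ′) (remQuot-combine ℓ i))

    c : V → Fin (G * t)
    c u = combine (colour u) (word u)

    c-proper : ∀ u v → u ~ v → c u ≢ c v
    c-proper u v adj same =
      let colour≡ , word≡ = combine-injective _ _ _ _ same in
      separate adj colour≡ λ {ℓ} i ℓ∈u ℓ∈v →
        trans (sym (word-bit u i ℓ∈u)) (trans (cong (λ j → H j (combine ℓ i)) word≡) (word-bit v i ℓ∈v))

-- Counting colours

n<2^n : ∀ n → n < 2 ^ n
n<2^n zero    = s≤s z≤n
n<2^n (suc n) = +-mono-≤ (m^n>0 2 n) (≤-trans (n<2^n n) (m≤m+n _ 0))

2n≤2^n : ∀ n → 1 ≤ n → 2 * n ≤ 2 ^ n
2n≤2^n (suc n) _ = *-monoʳ-≤ 2 (n<2^n n)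

-- Induction on `n - 2 * m`, starting from `(2 * m) ^ 2 ≤ (2 ^ m) ^ 2`.
2mn≤2^n : ∀ {m n} → 1 ≤ m → 2 * m ≤ n → 2 * (m * n) ≤ 2 ^ n
2mn≤2^n {m} {n} 1≤m 2m≤n = subst (λ n → 2 * (m * n) ≤ 2 ^ n) (m+[n∸m]≡n 2m≤n) (go (n ∸ 2 * m))
  where
  open ≤-Reasoning
  square : ∀ a → 2 * (a * (2 * a + 0)) ≡ (2 * a) * (2 * a)
  square = solve-∀
  next : ∀ a b → 2 * (a * (2 * a + suc b)) ≡ 2 * (a * (2 * a + b)) + 2 * a
  next = solve-∀
  go : ∀ t → 2 * (m * (2 * m + t)) ≤ 2 ^ (2 * m + t)
  go zero = begin
    2 * (m * (2 * m + 0))  ≡⟨ square m ⟩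
    (2 * m) * (2 * m)      ≤⟨ *-mono-≤ (2n≤2^n m 1≤m) (2n≤2^n m 1≤m) ⟩
    2 ^ m * 2 ^ m          ≡⟨ ^-distribˡ-+-* 2 m m ⟨
    2 ^ (m + m)            ≡⟨ cong (2 ^_) (trans (cong (m +_) (sym (+-identityʳ m))) (sym (+-identityʳ (2 * m)))) ⟩
    2 ^ (2 * m + 0)        ∎
  go (suc t) = begin
    2 * (m * (2 * m + suc t))          ≡⟨ next m t ⟩
    2 * (m * (2 * m + t)) + 2 * m      ≤⟨ +-mono-≤ (go t) (≤-trans (<⇒≤ (n<2^n (2 * m))) (^-monoʳ-≤ 2 (m≤m+n (2 * m) t))) ⟩
    2 ^ (2 * m + t) + 2 ^ (2 * m + t)  ≡⟨ cong (2 ^ (2 * m + t) +_) (+-identityʳ _) ⟨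
    2 ^ suc (2 * m + t)                ≡⟨ cong (2 ^_) (+-suc (2 * m) t) ⟨
    2 ^ (2 * m + suc t)                ∎

-- Here `2 ^ e` bounds the number of colours, and the other terms on the left reserve room for
-- finishing at once. Advancing replaces `e`, `k`, `s` by `e + k * 2 ^ s`, `s`, `r * s`. As `r ≥ 2`,
-- three of the four copies of `2 ^ (r * s)` dominate `(4 + s) * 2 ^ s`; the fourth absorbs
-- `2 * (s * (r * s))`.
invariant-step : ∀ {r e k s} → 2 ≤ r → 1 ≤ k → k ≤ s → e + 2 * (k * s) + k + 5 ≤ 4 * 2 ^ s →
                 (e + k * 2 ^ s) + 2 * (s * (r * s)) + s + 5 ≤ 4 * 2 ^ (r * s)
invariant-step {r} {e} {k} {s} 2≤r 1≤k k≤s inv = begin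
  (e + k * P) + 2 * (s * s′) + s + 5  ≡⟨ regroup e (k * P) (2 * (s * s′)) s ⟩
  (e + s + 5) + k * P + 2 * (s * s′)
    ≤⟨ +-mono-≤ (+-mono-≤ e+s+5≤ (*-monoˡ-≤ P k≤s)) (2mn≤2^n 1≤s 2s≤s′) ⟩
  4 * P + s * P + P′                  ≡⟨ cong (_+ P′) (*-distribʳ-+ P 4 s) ⟨
  (4 + s) * P + P′                    ≤⟨ +-monoˡ-≤ P′ (*-monoˡ-≤ P 4+s≤3P) ⟩
  3 * P * P + P′                      ≡⟨ cong (_+ P′) (*-assoc 3 P P) ⟩
  3 * (P * P) + P′                    ≤⟨ +-monoˡ-≤ P′ (*-monoʳ-≤ 3 PP≤P′) ⟩
  3 * P′ + P′                         ≡⟨ four P′ ⟩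
  4 * P′                              ∎
  where
  open ≤-Reasoning
  s′ = r * s
  P  = 2 ^ s
  P′ = 2 ^ s′
  1≤s = ≤-trans 1≤k k≤s
  2s≤s′ : 2 * s ≤ s′
  2s≤s′ = *-monoˡ-≤ s 2≤r
  regroup : ∀ a b c d → (a + b) + c + d + 5 ≡ (a + d + 5) + b + c
  regroup = solve-∀
  four : ∀ a → 3 * a + a ≡ 4 * a
  four = solve-∀
  e+s+5≤ : e + s + 5 ≤ 4 * P
  e+s+5≤ = ≤-trans (+-monoˡ-≤ 5 (≤-trans (+-monoʳ-≤ e s≤) (m≤m+n _ k))) inv
    where
    s≤ : s ≤ 2 * (k * s)
    s≤ = ≤-trans (≤-trans (≤-reflexive (sym (*-identityˡ s))) (*-monoˡ-≤ s 1≤k)) (m≤n*m (k * s) 2)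
  4+s≤3P : 4 + s ≤ 3 * P
  4+s≤3P = begin
    4 + s        ≡⟨ +-comm 3 (suc s) ⟩
    suc s + 3    ≤⟨ +-mono-≤ (n<2^n s) (≤-trans (n≤1+n 3) (*-monoʳ-≤ 2 (^-monoʳ-≤ 2 1≤s))) ⟩
    P + 2 * P    ∎
  PP≤P′ : P * P ≤ P′
  PP≤P′ = ≤-trans (≤-reflexive (sym (^-distribˡ-+-* 2 s s)))
    (^-monoʳ-≤ 2 (≤-trans (≤-reflexive (cong (s +_) (sym (+-identityʳ s)))) 2s≤s′))

cells-count : ∀ {x M} k → x ≤ 2 ^ M → suc (2 * (x * k)) ≤ 2 ^ (M + k + 1)
cells-count {x} {M} k x≤P = begin
  suc (2 * (x * k))      ≤⟨ +-mono-≤ (≤-trans (m^n>0 2 M) (m≤n*m P 2)) (*-monoʳ-≤ 2 (*-monoˡ-≤ k x≤P)) ⟩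
  2 * P + 2 * (P * k)    ≡⟨ factor P k ⟩
  P * (suc k) * 2        ≤⟨ *-monoˡ-≤ 2 (*-monoʳ-≤ P (n<2^n k)) ⟩
  P * 2 ^ k * 2          ≡⟨ cong (_* 2) (^-distribˡ-+-* 2 M k) ⟨
  2 ^ (M + k) * 2 ^ 1    ≡⟨ ^-distribˡ-+-* 2 (M + k) 1 ⟨
  2 ^ (M + k + 1)        ∎
  where
  open ≤-Reasoning
  P = 2 ^ M
  factor : ∀ a b → 2 * a + 2 * (a * b) ≡ a * suc b * 2
  factor = solve-∀

-- Isolates `M`, which is to be the iterated logarithm, as a linear factor; the rest goes into the
-- exponent of 2.
family-size : ∀ {M} K k → 1 ≤ M → (M + k + 1) * K * 2 ^ K + 1 ≤ 2 ^ (K + (K + suc k)) * M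
family-size {M} K k 1≤M = begin
  (M + k + 1) * K * D + 1            ≤⟨ +-mono-≤ (*-monoˡ-≤ D (*-monoˡ-≤ K M+k+1≤)) 1≤ ⟩
  M * (2 + k) * K * D + M * (2 + k) * D
    ≡⟨ factor (M * (2 + k)) K D ⟩
  D * (suc K * (M * (2 + k)))        ≤⟨ *-monoʳ-≤ D (*-mono-≤ (n<2^n K) (*-monoʳ-≤ M (n<2^n (suc k)))) ⟩
  D * (D * (M * 2 ^ suc k))          ≡⟨ regroup D (2 ^ suc k) M ⟩
  D * (D * 2 ^ suc k) * M            ≡⟨ cong (λ x → D * x * M) (^-distribˡ-+-* 2 K (suc k)) ⟨
  D * 2 ^ (K + suc k) * M            ≡⟨ cong (_* M) (^-distribˡ-+-* 2 K (K + suc k)) ⟨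
  2 ^ (K + (K + suc k)) * M          ∎
  where
  open ≤-Reasoning
  D = 2 ^ K
  factor : ∀ a b c → a * b * c + a * c ≡ c * (suc b * a)
  factor = solve-∀
  regroup : ∀ a b c → a * (a * (c * b)) ≡ a * (a * b) * c
  regroup = solve-∀
  M+k+1≤ : M + k + 1 ≤ M * (2 + k)
  M+k+1≤ = begin
    M + k + 1          ≡⟨ trans (+-assoc M k 1) (cong (M +_) (+-comm k 1)) ⟩
    M + suc k          ≤⟨ +-monoʳ-≤ M (≤-trans (≤-reflexive (sym (*-identityˡ (suc k)))) (*-monoˡ-≤ (suc k) 1≤M)) ⟩
    M + M * suc k      ≡⟨ *-suc M (suc k) ⟨
    M * (2 + k)        ∎
  1≤ : 1 ≤ M * (2 + k) * D
  1≤ = *-mono-≤ (*-mono-≤ 1≤M (s≤s {n = suc k} z≤n)) (m^n>0 2 K)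

module _ {V : Set} (_~_ : V → V → Set) (~-sym : ∀ u v → u ~ v → v ~ u) where

  -- Advances `n` times and then finishes. The `4` in `f + 4` later pays for a factor below `2 ^ 3`
  -- and for a strict inequality.
  stage-colouring : ∀ n {r N k G s e} → 2 ≤ r → 1 ≤ k → k ≤ s → G ≤ 2 ^ e →
    e + 2 * (k * s) + k + 5 ≤ 4 * 2 ^ s → Stage _~_ ~-sym r n N k G s →
    ∃ λ f → f + 4 ≤ 4 * 2 ^ (r ^ n * s) ×
    ∃ λ K → K ≤ 2 ^ f * iterLg (2 * suc n) N × Colouring _~_ K
  stage-colouring zero {r} {N} {k} {G} {s} {e} 2≤r 1≤k k≤s G≤ inv S =
    f , f+4≤ , G * t , bound , proj₂ (proj₂ coloured)
    where
    open ≤-Reasoning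
    M = lg (lg N)
    K = s * k
    f = e + (K + (K + suc k))
    coloured = finish _~_ ~-sym ((M + k + 1) * K) (≤-trans 1≤k k≤s)
      (≤-trans (^-monoˡ-≤ K (cells-count {lg N} {M} k (n≤2^lg (lg N))))
               (≤-reflexive (^-*-assoc 2 (M + k + 1) K)))
      S
    t = proj₁ coloured
    bound : G * t ≤ 2 ^ f * M
    bound = begin
      G * t                              ≤⟨ *-mono-≤ G≤ (≤-trans (proj₁ (proj₂ coloured)) (family-size K k (s≤s z≤n))) ⟩
      2 ^ e * (2 ^ (K + (K + suc k)) * M) ≡⟨ *-assoc (2 ^ e) _ M ⟨
      2 ^ e * 2 ^ (K + (K + suc k)) * M  ≡⟨ cong (_* M) (^-distribˡ-+-* 2 e _) ⟨
      2 ^ f * M                          ∎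
    regroup : ∀ e k s → e + (s * k + (s * k + suc k)) + 4 ≡ e + 2 * (k * s) + k + 5
    regroup = solve-∀
    f+4≤ : f + 4 ≤ 4 * 2 ^ (1 * s)
    f+4≤ = begin
      f + 4                       ≡⟨ regroup e k s ⟩
      e + 2 * (k * s) + k + 5     ≤⟨ inv ⟩
      4 * 2 ^ s                   ≡⟨ cong (λ x → 4 * 2 ^ x) (*-identityˡ s) ⟨
      4 * 2 ^ (1 * s)             ∎
  stage-colouring (suc n) {r} {N} {k} {G} {s} {e} 2≤r 1≤k k≤s G≤ inv S =
    let f , f≤ , K , K≤ , c = stage-colouring n {e = e + k * 2 ^ s} 2≤r 1≤s s≤rs G′≤ (invariant-step {e = e} 2≤r 1≤k k≤s inv)
                                (advance _~_ ~-sym (<⇒≤ 2≤r) 1≤s S)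
    in f , subst (λ x → f + 4 ≤ 4 * 2 ^ x) exponent≡ f≤ , K , subst (λ x → K ≤ 2 ^ f * x) iterLg≡ K≤ , c
    where
    1≤s  = ≤-trans 1≤k k≤s
    s≤rs : s ≤ r * s
    s≤rs = ≤-trans (≤-reflexive (sym (*-identityˡ s))) (*-monoˡ-≤ s (<⇒≤ 2≤r))
    exponent≡ : r ^ n * (r * s) ≡ r ^ suc n * s
    exponent≡ = trans (sym (*-assoc (r ^ n) r s)) (cong (_* s) (*-comm (r ^ n) r))
    G′≤ : G * (2 ^ k) ^ (2 ^ s) ≤ 2 ^ (e + k * 2 ^ s)
    G′≤ = ≤-trans (*-mono-≤ G≤ (≤-reflexive (^-*-assoc 2 k (2 ^ s))))
                  (≤-reflexive (sym (^-distribˡ-+-* 2 e (k * 2 ^ s))))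
    -- Advancing takes its two logarithms innermost, whereas `iterLg` adds them outermost.
    iterLg≡ : iterLg (2 * suc n) (lg (lg N)) ≡ iterLg (2 * suc (suc n)) N
    iterLg≡ = trans (iterLg-lg (2 * suc n) (lg N))
      (trans (cong lg (iterLg-lg (2 * suc n) N)) (cong (λ j → iterLg j N) (sym (*-suc 2 (suc n)))))

-- Colouring the graphs W_r

elements : ∀ {m} → Subset m → List (Fin m)
elements []            = []
elements (inside ∷ p)  = zero ∷ map suc (elements p)
elements (outside ∷ p) = map suc (elements p)

length-elements : ∀ {m} (p : Subset m) → length (elements p) ≡ ∣ p ∣
length-elements []            = refl
length-elements (inside ∷ p)  = cong suc (trans (length-map suc (elements p)) (length-elements p))
length-elements (outside ∷ p) = trans (length-map suc (elements p)) (length-elements p)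

∈-elements⁺ : ∀ {m} {p : Subset m} {x} → x Subset.∈ p → x ∈ elements p
∈-elements⁺ here = here refl
∈-elements⁺ {p = inside ∷ p}  (there x∈p) = there (∈-map⁺ suc (∈-elements⁺ x∈p))
∈-elements⁺ {p = outside ∷ p} (there x∈p) = ∈-map⁺ suc (∈-elements⁺ x∈p)

∈-elements⁻ : ∀ {m} {p : Subset m} {x} → x ∈ elements p → x Subset.∈ p
∈-elements⁻ {p = inside ∷ p} (here refl) = here
∈-elements⁻ {p = inside ∷ p} (there x∈) with ∈-map⁻ suc x∈
... | y , y∈ , refl = there (∈-elements⁻ y∈)
∈-elements⁻ {p = outside ∷ p} x∈ with ∈-map⁻ suc x∈
... | y , y∈ , refl = there (∈-elements⁻ y∈)

elements-mono : ∀ {m} {p q : Subset m} → p Subset.⊆ q → elements p ⊆ elements q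
elements-mono p⊆q = ∈-elements⁺ ∘ p⊆q ∘ ∈-elements⁻

Adj-sym : ∀ {r m σ δ} (u v : Vertex r m σ δ) → Adj u v → Adj v u
Adj-sym _ _ (α≢ , αu∈ , αv∈ , interlaced) =
  ≢-sym α≢ , αv∈ , αu∈ , λ i j e → let p , q = interlaced i j e in q , p

-- One colour and the single point `α`, which already distinguishes adjacent vertices.
initialStage : ∀ r m σ n → Stage {Vertex r m σ (suc n)} Adj Adj-sym r n m 1 1 (r ^ σ)
initialStage r m σ n = record
  { sets       = λ i u → elements (A u i)
  ; size≤      = λ i u → ≤-reflexive (trans (length-elements (A u i)) (size u i))
  ; nested     = λ i u → elements-mono (proj₁ (chain u (inject₁ i) (suc i) (next i)))
  ; interlaced = λ (_ , _ , _ , p) i → elements-mono (proj₁ (p (inject₁ i) (suc i) (next i)))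
  ; colour     = λ _ → zero
  ; points     = λ u _ → α u
  ; points∈    = λ u _ → ∈-elements⁺ (α∈A₁ u zero refl)
  ; points∈′   = λ (_ , p , _) _ → ∈-elements⁺ (p zero refl)
  ; proper     = λ (α≢ , _) _ p → α≢ (p zero)
  }
  where
  next : ∀ {n} (i : Fin n) → suc (toℕ i) ≡ suc (toℕ (inject₁ i))
  next i = cong suc (sym (toℕ-inject₁ i))

W-colouring : ∀ r m σ n → 2 ≤ r →
  ∃ λ f → f + 4 ≤ 4 * 2 ^ (r ^ n * r ^ σ) ×
  ∃ λ K → K ≤ 2 ^ f * iterLg (2 * suc n) m × ProperColouring r m σ (suc n) K
W-colouring r m σ n 2≤r =
  stage-colouring Adj Adj-sym n {e = 0} 2≤r ≤-refl 1≤s ≤-refl inv (initialStage r m σ n)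
  where
  open ≤-Reasoning
  s = r ^ σ
  1≤s : 1 ≤ s
  1≤s = m^n>0 r {{>-nonZero (<⇒≤ 2≤r)}} σ
  regroup : ∀ s → 2 * (1 * s) + 1 + 5 ≡ 2 * suc s + 4
  regroup = solve-∀
  four : ∀ a → 2 * a + 2 * a ≡ 4 * a
  four = solve-∀
  inv : 2 * (1 * s) + 1 + 5 ≤ 4 * 2 ^ s
  inv = begin
    2 * (1 * s) + 1 + 5    ≡⟨ regroup s ⟩
    2 * suc s + 4          ≤⟨ +-mono-≤ (*-monoʳ-≤ 2 (n<2^n s)) (*-monoʳ-≤ 2 (^-monoʳ-≤ 2 1≤s)) ⟩
    2 * 2 ^ s + 2 * 2 ^ s  ≡⟨ four (2 ^ s) ⟩
    4 * 2 ^ s              ∎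

-- From integers to cuts

-- Exhibits the lowest terms, reducing order and arithmetic to the integers.
ℕ→ℚ≡mkℚ : ∀ n → ℕ→ℚ n ≡ mkℚ (ℤ.+ n) 0 (Coprime.sym (Coprime.1-coprimeTo n))
ℕ→ℚ≡mkℚ n = ℚ.normalize-coprime (Coprime.sym (Coprime.1-coprimeTo n))

↥-ℕ→ℚ : ∀ n → ↥ (ℕ→ℚ n) ≡ ℤ.+ n
↥-ℕ→ℚ n = cong ↥_ (ℕ→ℚ≡mkℚ n)

↧ₙ-ℕ→ℚ : ∀ n → ↧ₙ (ℕ→ℚ n) ≡ 1
↧ₙ-ℕ→ℚ n = cong ↧ₙ_ (ℕ→ℚ≡mkℚ n)

ℕ→ℚ-mono-< : ∀ {i j} → i < j → ℕ→ℚ i ℚ.< ℕ→ℚ j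
ℕ→ℚ-mono-< {i} {j} i<j rewrite ℕ→ℚ≡mkℚ i | ℕ→ℚ≡mkℚ j =
  *<* (subst₂ ℤ._<_ (sym (ℤ.*-identityʳ (ℤ.+ i))) (sym (ℤ.*-identityʳ (ℤ.+ j))) (ℤ.+<+ i<j))

ℕ→ℚ-mono-≤ : ∀ {i j} → i ≤ j → ℕ→ℚ i ℚ.≤ ℕ→ℚ j
ℕ→ℚ-mono-≤ {i} {j} i≤j rewrite ℕ→ℚ≡mkℚ i | ℕ→ℚ≡mkℚ j =
  *≤* (subst₂ ℤ._≤_ (sym (ℤ.*-identityʳ (ℤ.+ i))) (sym (ℤ.*-identityʳ (ℤ.+ j))) (ℤ.+≤+ i≤j))

ℕ→ℚ-* : ∀ i j → ℕ→ℚ (i * j) ≡ ℕ→ℚ i ℚ.* ℕ→ℚ j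
ℕ→ℚ-* i j rewrite ℕ→ℚ≡mkℚ i | ℕ→ℚ≡mkℚ j = cong (λ z → z ℚ./ 1) (ℤ.pos-* i j)

ℕ→ℚ-+ : ∀ i j → ℕ→ℚ (i + j) ≡ ℕ→ℚ i ℚ.+ ℕ→ℚ j
ℕ→ℚ-+ i j rewrite ℕ→ℚ≡mkℚ i | ℕ→ℚ≡mkℚ j =
  cong (λ z → z ℚ./ 1) (trans (ℤ.pos-+ i j) (sym (cong₂ ℤ._+_ (ℤ.*-identityʳ (ℤ.+ i)) (ℤ.*-identityʳ (ℤ.+ j)))))

exp2Lt-ℕ : ∀ {n t} → 2 ^ n < t → Exp2Lt (ℕ→ℚ n) (ℕ→ℚ t)
exp2Lt-ℕ {n} {t} 2^n<t =
  ℕ→ℚ-mono-< (≤-<-trans z≤n 2^n<t) ,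
  subst₂ (λ e d → powℤ 2 e ℚ.< powℚ (ℕ→ℚ t) d) (sym (↥-ℕ→ℚ n)) (sym (↧ₙ-ℕ→ℚ n))
    (subst (ℕ→ℚ (2 ^ n) ℚ.<_) (sym (ℚ.*-identityʳ (ℕ→ℚ t))) (ℕ→ℚ-mono-< 2^n<t))

ltExp2-ℕ : ∀ {c n} → 0 < c → c < 2 ^ n → LtExp2 (ℕ→ℚ c) (ℕ→ℚ n)
ltExp2-ℕ {c} {n} 0<c c<2^n = inj₂
  (ℕ→ℚ-mono-< 0<c ,
   subst₂ (λ e d → powℚ (ℕ→ℚ c) d ℚ.< powℤ 2 e) (sym (↥-ℕ→ℚ n)) (sym (↧ₙ-ℕ→ℚ n))
     (subst (ℚ._< ℕ→ℚ (2 ^ n)) (sym (ℚ.*-identityʳ (ℕ→ℚ c))) (ℕ→ℚ-mono-< c<2^n)))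

-- The slack 2 survives taking logarithms, since 2 ^ suc n ≥ 2 ^ n + 2.
iterLog-above : ∀ m j n → 1 ≤ n → n + 2 ≤ iterLg j m → iterLog j (ratCut (ℕ→ℚ m)) (ℕ→ℚ n)
iterLog-above m zero    n 1≤n p = ℕ→ℚ-mono-< (<-≤-trans (m<m+n n (s≤s z≤n)) p)
iterLog-above m (suc j) n 1≤n p =
  ℕ→ℚ t , exp2Lt-ℕ {n} ≤-refl , iterLog-above m j t (s≤s z≤n) t+2≤
  where
  open ≤-Reasoning
  t = suc (2 ^ n)
  regroup : ∀ a → suc a + 2 ≡ suc (a + 2)
  regroup = solve-∀
  t+2≤ : t + 2 ≤ iterLg j m
  t+2≤ = begin
    suc (2 ^ n) + 2          ≡⟨ regroup (2 ^ n) ⟩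
    suc (2 ^ n + 2)          ≤⟨ s≤s (+-monoʳ-≤ (2 ^ n) (≤-trans (^-monoʳ-≤ 2 1≤n) (m≤m+n _ 0))) ⟩
    suc (2 ^ suc n)            ≤⟨ lg-minimal (iterLg j m) (suc n) (s≤s z≤n) (subst (_≤ iterLg (suc j) m) (+-comm n 2) p) ⟩
    iterLg j m                 ∎

-- The factor 6 absorbs M ≤ 6 l for M = iterLg j m, where l = M - 2 if M ≥ 3 and l = ½ otherwise.
lower-log : ∀ m j f K → 1ℚ ≤ʳ iterLog j (ratCut (ℕ→ℚ m)) → K ≤ 2 ^ f * iterLg j m →
  ∃ λ l → 0ℚ ℚ.< l × iterLog j (ratCut (ℕ→ℚ m)) l × ℕ→ℚ K ℚ.≤ ℕ→ℚ (6 * 2 ^ f) ℚ.* l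
lower-log m j f K 1≤log K≤ with iterLg j m ≤? 2
... | yes M≤2 = ½ , ℚ.positive⁻¹ ½ , 1≤log ½ (*<* (ℤ.+<+ (s≤s (s≤s z≤n)))) ,
  (begin
    -- Raising 2 to 3 matches the target, since `3 = 6 * ½`.
    ℕ→ℚ K                              ≤⟨ ℕ→ℚ-mono-≤ (≤-trans K≤ (*-monoʳ-≤ (2 ^ f) (≤-trans M≤2 (n≤1+n 2)))) ⟩
    ℕ→ℚ (2 ^ f * 3)                    ≡⟨ ℚ.*-identityʳ _ ⟨
    ℕ→ℚ (2 ^ f * 3) ℚ.* (ℕ→ℚ 2 ℚ.* ½)  ≡⟨ ℚ.*-assoc (ℕ→ℚ (2 ^ f * 3)) (ℕ→ℚ 2) ½ ⟨
    ℕ→ℚ (2 ^ f * 3) ℚ.* ℕ→ℚ 2 ℚ.* ½    ≡⟨ cong (ℚ._* ½) (ℕ→ℚ-* (2 ^ f * 3) 2) ⟨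
    ℕ→ℚ (2 ^ f * 3 * 2) ℚ.* ½          ≡⟨ cong (λ x → ℕ→ℚ x ℚ.* ½) (six (2 ^ f)) ⟩
    ℕ→ℚ (6 * 2 ^ f) ℚ.* ½              ∎)
  where
  open ℚ.≤-Reasoning
  six : ∀ a → a * 3 * 2 ≡ 6 * a
  six = solve-∀
... | no M≰2 = ℕ→ℚ n , ℕ→ℚ-mono-< 1≤n , iterLog-above m j n 1≤n (≤-reflexive n+2≡M) ,
  ℚ.≤-trans (ℕ→ℚ-mono-≤ bound) (ℚ.≤-reflexive (ℕ→ℚ-* (6 * 2 ^ f) n))
  where
  open ≤-Reasoning
  M = iterLg j m
  n = M ∸ 2
  n+2≡M : n + 2 ≡ M
  n+2≡M = m∸n+n≡m (<⇒≤ (≰⇒> M≰2))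
  1≤n : 1 ≤ n
  1≤n = +-cancelʳ-≤ 2 1 n (≤-trans (≰⇒> M≰2) (≤-reflexive (sym n+2≡M)))
  six : ∀ a b → a * (6 * b) ≡ 6 * a * b
  six = solve-∀
  parts : ∀ a → 6 * a ≡ a + 2 * a + 3 * a
  parts = solve-∀
  bound : K ≤ 6 * 2 ^ f * n
  bound = begin
    K                  ≤⟨ K≤ ⟩
    2 ^ f * M          ≡⟨ cong (2 ^ f *_) n+2≡M ⟨
    2 ^ f * (n + 2)  ≤⟨ *-monoʳ-≤ (2 ^ f) (+-monoʳ-≤ n (*-monoʳ-≤ 2 1≤n)) ⟩
    2 ^ f * (n + 2 * n)  ≤⟨ *-monoʳ-≤ (2 ^ f) (m≤m+n _ (3 * n)) ⟩
    2 ^ f * (n + 2 * n + 3 * n)  ≡⟨ cong (2 ^ f *_) (parts n) ⟨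
    2 ^ f * (6 * n)    ≡⟨ six (2 ^ f) n ⟩
    6 * 2 ^ f * n      ∎

-- The cut witnesses form the chain `6 * 2 ^ f < 2 ^ (f + 3)`, `f + 3 < 2 ^ (2 + S)`,
-- `2 + S < exponent r σ δ`; the factor 6 pays for passing from `iterLg` to the real logarithm.
below-boundCut : ∀ r σ δ m S f K → ℕ→ℚ (2 + S) ℚ.< exponent r σ δ → f + 4 ≤ 4 * 2 ^ S →
  1ℚ ≤ʳ iterLog (2 * δ) (ratCut (ℕ→ℚ m)) → K ≤ 2 ^ f * iterLg (2 * δ) m →
  ℕ→ℚ K ≤ʳ boundCut r σ δ m
below-boundCut r σ δ m S f K S< f≤ 1≤log K≤ q q<K =
  let l , 0<l , log-l , K≤cl = lower-log m (2 * δ) f K 1≤log K≤ in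
  ℕ→ℚ (6 * 2 ^ f) , l , ℕ→ℚ-mono-< 0<c , 0<l ,
  (ℕ→ℚ (f + 3) ,
    (ℕ→ℚ (2 + S) , S< , ltExp2-ℕ {f + 3} {2 + S} (m≤n⇒m≤o+n f (s≤s z≤n)) f+3<) ,
    ltExp2-ℕ {6 * 2 ^ f} {f + 3} 0<c c<) ,
  log-l , ℚ.<-≤-trans q<K K≤cl
  where
  open ≤-Reasoning
  0<c : 0 < 6 * 2 ^ f
  0<c = *-mono-≤ {1} {6} (s≤s z≤n) (m^n>0 2 f)
  c< : 6 * 2 ^ f < 2 ^ (f + 3)
  c< = begin-strict
    6 * 2 ^ f          <⟨ *-monoˡ-< (2 ^ f) {{m^n≢0 2 f}} (n<1+n 6) ⟩
    7 * 2 ^ f          ≤⟨ *-monoˡ-≤ (2 ^ f) (n≤1+n 7) ⟩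
    8 * 2 ^ f          ≡⟨ *-comm 8 (2 ^ f) ⟩
    2 ^ f * 2 ^ 3      ≡⟨ ^-distribˡ-+-* 2 f 3 ⟨
    2 ^ (f + 3)      ∎
  f+3< : f + 3 < 2 ^ (2 + S)
  f+3< = begin-strict
    f + 3            <⟨ +-monoʳ-< f (n<1+n 3) ⟩
    f + 4            ≤⟨ f≤ ⟩
    4 * 2 ^ S          ≡⟨ ^-distribˡ-+-* 2 2 S ⟨
    2 ^ (2 + S)      ∎

-- Lower bounds for the exponent

powℚ-positive : ∀ q n → 0ℚ ℚ.< q → 0ℚ ℚ.< powℚ q n
powℚ-positive q zero    0<q = ℚ.positive⁻¹ 1ℚ
powℚ-positive q (suc n) 0<q = ℚ.positive⁻¹ (q ℚ.* powℚ q n)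
  {{ℚ.pos*pos⇒pos q {{ℚ.positive 0<q}} (powℚ q n) {{ℚ.positive (powℚ-positive q n 0<q)}}}}

powℤ-positive : ∀ r z → 0ℚ ℚ.< powℤ (suc r) z
powℤ-positive r (ℤ.+ n)    = ℕ→ℚ-mono-< (m^n>0 (suc r) n)
powℤ-positive r -[1+ n ] = powℚ-positive ((ℤ.+ 1) ℚ./ suc r) (suc n) (ℚ.positive⁻¹ ((ℤ.+ 1) ℚ./ suc r) {{ℚ.normalize-pos 1 (suc r)}})

1/r*r : ∀ r → ((ℤ.+ 1) ℚ./ suc r) ℚ.* ℕ→ℚ (suc r) ≡ 1ℚ
1/r*r r = begin
  ((ℤ.+ 1) ℚ./ suc r) ℚ.* ℕ→ℚ (suc r)  ≡⟨ cong₂ ℚ._*_ (ℚ.normalize-coprime (Coprime.1-coprimeTo (suc r))) (ℕ→ℚ≡mkℚ (suc r)) ⟩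
  ℚ.1/ r′ ℚ.* r′                     ≡⟨ ℚ.*-inverseˡ r′ ⟩
  1ℚ                                 ∎
  where
  open ≡-Reasoning
  r′ = mkℚ (ℤ.+ suc r) 0 (Coprime.sym (Coprime.1-coprimeTo (suc r)))

-- For `δ = 0` the power of the base may have a negative exponent, but its positivity is enough.
exponent₀ : ∀ r σ → ℕ→ℚ 2 ℚ.< exponent (suc r) σ 0
exponent₀ r σ = ℚ.+-monoʳ-< (ℕ→ℚ 2) (ℚ.positive⁻¹ (p ℚ.* s)
  {{ℚ.pos*pos⇒pos p {{ℚ.positive (powℤ-positive r z)}} s {{ℚ.positive (ℕ→ℚ-mono-< {j = suc (suc r)} (s≤s z≤n))}}}})
  where
  z = (ℤ.+ σ) ℤ.+ (ℤ.+ 0) ℤ.- (ℤ.+ 2)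
  p = powℤ (suc r) z
  s = ℕ→ℚ (suc (suc r))

-- Since `suc a ⊖ 2` is `a - 1`, the right side is `suc r ^ a` with one factor `suc r` enlarged to
-- `suc (suc r)`. For `a = 0` the power is the reciprocal of `suc r`.
powℤ-pred : ∀ r a → ℕ→ℚ (suc r ^ a) ℚ.< powℤ (suc r) (suc a ℤ.⊖ 2) ℚ.* ℕ→ℚ (suc (suc r))
powℤ-pred r zero = begin-strict
  1ℚ                                              ≡⟨ 1/r*r r ⟨
  ((ℤ.+ 1) ℚ./ suc r) ℚ.* ℕ→ℚ (suc r)
    <⟨ ℚ.*-monoʳ-<-pos ((ℤ.+ 1) ℚ./ suc r) {{ℚ.normalize-pos 1 (suc r)}} (ℕ→ℚ-mono-< (n<1+n (suc r))) ⟩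
  ((ℤ.+ 1) ℚ./ suc r) ℚ.* ℕ→ℚ (suc (suc r))
    ≡⟨ cong (ℚ._* ℕ→ℚ (suc (suc r))) (ℚ.*-identityʳ ((ℤ.+ 1) ℚ./ suc r)) ⟨
  ((ℤ.+ 1) ℚ./ suc r) ℚ.* 1ℚ ℚ.* ℕ→ℚ (suc (suc r))  ∎
  where open ℚ.≤-Reasoning
powℤ-pred r (suc a) = begin-strict
  ℕ→ℚ (suc r * suc r ^ a)                ≡⟨ cong ℕ→ℚ (*-comm (suc r) (suc r ^ a)) ⟩
  ℕ→ℚ (suc r ^ a * suc r)                <⟨ ℕ→ℚ-mono-< (*-monoʳ-< (suc r ^ a) {{m^n≢0 (suc r) a}} (n<1+n (suc r))) ⟩
  ℕ→ℚ (suc r ^ a * suc (suc r))          ≡⟨ ℕ→ℚ-* (suc r ^ a) (suc (suc r)) ⟩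
  ℕ→ℚ (suc r ^ a) ℚ.* ℕ→ℚ (suc (suc r))  ∎
  where open ℚ.≤-Reasoning

exponent₊ : ∀ r σ n → ℕ→ℚ (2 + suc r ^ n * suc r ^ σ) ℚ.< exponent (suc r) σ (suc n)
exponent₊ r σ n = begin-strict
  ℕ→ℚ (2 + suc r ^ n * suc r ^ σ)       ≡⟨ cong (λ x → ℕ→ℚ (2 + x)) (^-distribˡ-+-* (suc r) n σ) ⟨
  ℕ→ℚ (2 + suc r ^ (n + σ))           ≡⟨ ℕ→ℚ-+ 2 (suc r ^ (n + σ)) ⟩
  ℕ→ℚ 2 ℚ.+ ℕ→ℚ (suc r ^ (n + σ))       <⟨ ℚ.+-monoʳ-< (ℕ→ℚ 2) (powℤ-pred r (n + σ)) ⟩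
  ℕ→ℚ 2 ℚ.+ powℤ (suc r) (suc (n + σ) ℤ.⊖ 2) ℚ.* ℕ→ℚ (suc (suc r))
    ≡⟨ cong (λ x → ℕ→ℚ 2 ℚ.+ powℤ (suc r) (x ℤ.⊖ 2) ℚ.* ℕ→ℚ (suc (suc r))) (+-comm (suc n) σ) ⟩
  exponent (suc r) σ (suc n)              ∎
  where open ℚ.≤-Reasoning

theorem3p3 : (r σ δ m : ℕ) → 2 ≤ r →
    1ℚ ≤ʳ iterLog (2 * δ) (ratCut (ℕ→ℚ m)) →
    χ≤ r m σ δ (boundCut r σ δ m)
theorem3p3 (suc r) σ zero m 2≤r 1≤log =
  -- Without sets, `α` is a proper colouring with `m` colours, and no logarithm is taken;
  -- `f = S = 0` fits the bound.
  m , (α , λ u v adj → proj₁ adj) ,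
  below-boundCut (suc r) σ 0 m 0 0 m (exponent₀ r σ) ≤-refl 1≤log (≤-reflexive (sym (*-identityˡ m)))
theorem3p3 (suc r) σ (suc n) m 2≤r 1≤log =
  let f , f≤ , K , K≤ , c = W-colouring (suc r) m σ n 2≤r in
  K , c , below-boundCut (suc r) σ (suc n) m (suc r ^ n * suc r ^ σ) f K (exponent₊ r σ n) f≤ 1≤log K≤
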